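{- For every integer $n\geq 3$, $ir_b(C_n)=\gamma_b(C_n)=\left\lceil\frac{n}{3}\right\rceil$, where $C_n$ is the cycle of order $n$.
   Context: For a graph $G=(V,E)$, a broadcast is a function $f:V\to\{0,\dots,\operatorname{diam}(G)\}$ with $f(v)\le e_G(v)$ (eccentricity) for all $v$. Let $V^+_f=\{v: f(v)>0\}$ and $H_f(u)=\{v\in V^+_f: d_G(u,v)\le f(v)\}$. For $v\in V^+_f$, $PN_f(v)=\{u\in V: H_f(u)=\{v\}\}$, and $PB_f(v)$ is $\{v\}$ if $f(v)=1$ and $PN_f(v)=\{v\}$, and otherwise $PB_f(v)=\{u\in PN_f(v): d_G(u,v)=f(v)\}$. The cost is $\sigma(f)=\sum_v f(v)$. $f$ is dominating if $|H_f(u)|\ge1$ for all $u$; $\gamma_b(G)$ is the minimum cost of a dominating broadcast. $f$ is irredundant if $PB_f(v)\ne\emptyset$ for every $v\in V^+_f$; it is maximal irredundant if no irredundant broadcast $g\ne f$ satisfies $g\ge f$ pointwise; $ir_b(G)$ is the minimum cost of a maximal irredundant broadcast. -}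

module Defs where

open import Data.Nat using (ℕ; zero; suc; _+_; _<_; _≤_; _∸_)
open import Data.Nat.DivMod using (_/_)
open import Data.Fin using (Fin; toℕ)
open import Data.List using (map; allFin)
open import Data.Nat.ListAction using (sum)
open import Data.Product using (Σ; ∃; _×_)
open import Data.Sum using (_⊎_)
open import Relation.Nullary using (¬_)
open import Relation.Binary.PropositionalEquality using (_≡_)

record Graph : Set₁ where
  field
    n   : ℕ
    Adj : Fin n → Fin n → Set

open Graph public

-- The cycle C_n on vertices 0,…,n-1 with i ~ i+1 (mod n).
-- (Used with n ≥ 3, where this is the simple cycle of order n.)
CycleAdj : (n : ℕ) → Fin n → Fin n → Set
CycleAdj n i j =
  (toℕ j ≡ suc (toℕ i)) ⊎ (toℕ i ≡ suc (toℕ j)) ⊎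
  (suc (toℕ i) ≡ n × toℕ j ≡ 0) ⊎ (suc (toℕ j) ≡ n × toℕ i ≡ 0)

Cycle : ℕ → Graph
Cycle n = record { n = n ; Adj = CycleAdj n }

module _ (G : Graph) where

  V : Set
  V = Fin (n G)

  -- Reach k u v  ⇔  there is a walk of length ≤ k from u to v  ⇔  d_G(u,v) ≤ k.
  data Reach : ℕ → V → V → Set where
    here : ∀ {k u} → Reach k u u
    step : ∀ {k u w v} → Adj G u w → Reach k w v → Reach (suc k) u v

  DistLe : ℕ → V → V → Set
  DistLe k u v = Reach k u v

  DistGe : ℕ → V → V → Set
  DistGe k u v = ∀ j → j < k → ¬ Reach j u v

  DistEq : ℕ → V → V → Set
  DistEq k u v = DistLe k u v × DistGe k u v

  -- f(v) ≤ e_G(v): some vertex is at distance ≥ f(v) from v.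
  -- (For connected G this also gives f(v) ≤ diam(G).)
  IsBroadcast : (V → ℕ) → Set
  IsBroadcast f = ∀ v → ∃ λ u → DistGe (f v) v u

  cost : (V → ℕ) → ℕ
  cost f = sum (map f (allFin (n G)))

  InH : (V → ℕ) → V → V → Set
  InH f u v = (0 < f v) × DistLe (f v) u v

  IsDominating : (V → ℕ) → Set
  IsDominating f = IsBroadcast f × (∀ u → ∃ λ v → InH f u v)

  InPN : (V → ℕ) → V → V → Set
  InPN f v u = InH f u v × (∀ w → InH f u w → w ≡ v)

  PNSingleton : (V → ℕ) → V → Set
  PNSingleton f v = ∀ u → (InPN f v u → u ≡ v) × (u ≡ v → InPN f v u)

  InPB : (V → ℕ) → V → V → Set
  InPB f v u =
    ((f v ≡ 1 × PNSingleton f v) × u ≡ v) ⊎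
    (¬ (f v ≡ 1 × PNSingleton f v) × InPN f v u × DistEq (f v) u v)

  IsIrredundant : (V → ℕ) → Set
  IsIrredundant f = IsBroadcast f × (∀ v → 0 < f v → ∃ λ u → InPB f v u)

  IsMaximalIrredundant : (V → ℕ) → Set
  IsMaximalIrredundant f =
    IsIrredundant f ×
    (∀ g → IsIrredundant g → (∀ v → f v ≤ g v) → ∀ v → g v ≡ f v)

  IsMinCost : ((V → ℕ) → Set) → ℕ → Set
  IsMinCost P k = (∃ λ f → P f × cost f ≡ k) × (∀ f → P f → k ≤ cost f)

  IrB≡ : ℕ → Set
  IrB≡ = IsMinCost IsMaximalIrredundant

  γB≡ : ℕ → Set
  γB≡ = IsMinCost IsDominating

ceil/3 : ℕ → ℕ
ceil/3 n = (n + 2) / 3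

{-# OPTIONS --safe #-}

-- Upper bounds: put strength 1 on the multiples of 3. This broadcast is dominating
-- and irredundant, and such broadcasts are maximal irredundant in every graph.
--
-- Lower bounds: the ball of a vertex of strength k ≥ 1 has at most 2k + 1 ≤ 3k
-- elements, which settles dominating broadcasts. For a maximal irredundant f, give
-- v the 2 f(v) + 1 slots v − f(v), …, v + f(v); the slots must be made to cover the
-- undominated vertices too. Giving an undominated u strength 1 destroys the private
-- boundary of some v, so u is next to an end of the ball of v, say u = v + f(v) + 1,
-- where v + f(v) is private to v. Raising v to f(v) + 1 instead must destroy another
-- private boundary, which then lies at v − f(v) − 1; hence v − f(v) is not private
-- to v (else it too would be next to u, making v − f(v) − 1 = u dominated), and its
-- slot is redirected to u. It remains to see that v − f(v) occupies an unredirected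
-- slot of another vertex, which follows from the boundary vertex at v − f(v) − 1.
module Submission where

open import Defs
open import Data.Nat using (ℕ; zero; suc; _+_; _*_; _∸_; _≤_; _<_; z≤n; s≤s; s≤s⁻¹; _<?_)
open import Data.Nat.Properties as ℕ using (≤-refl; ≤-trans; ≤-reflexive; m≤n⇒m<n∨m≡n)
open import Data.Nat.DivMod using (m<n*o⇒m/o<n; m/n≡1+[m∸n]/n)
open import Data.Nat.ListAction using (sum)
open import Data.Nat.Solver using (module +-*-Solver)
open import Data.Fin using (Fin; zero; suc; toℕ; fromℕ; fromℕ<; inject₁; lower₁)
open import Data.Fin.Properties using (_≟_; any?; all?; ¬∀⟶∃¬; injective⇒≤; toℕ-injective; toℕ<n; toℕ-fromℕ; toℕ-fromℕ<; toℕ-inject₁; toℕ-lower₁)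
open import Data.List using (List; []; _∷_; _++_; map; length; lookup; concatMap; allFin; tabulate)
open import Data.List.Properties using (length-++; map-tabulate)
open import Data.List.Membership.Propositional using (_∈_; lose)
open import Data.List.Membership.Propositional.Properties using (∈-concatMap⁺; ∈-allFin)
open import Data.List.Relation.Unary.Any using (here; there; index)
open import Data.List.Relation.Unary.Any.Properties using (lookup-index)
open import Data.Product using (∃; _×_; _,_; proj₁; proj₂)
open import Data.Sum using (_⊎_; inj₁; inj₂; [_,_]′)
open import Data.Vec.Functional using (updateAt)
open import Data.Vec.Functional.Properties using (updateAt-updates; updateAt-minimal)
open import Function using (_∘_; const)
open import Relation.Nullary using (¬_; Dec; yes; no; contradiction)
open import Relation.Nullary.Decidable using (_×-dec_; _⊎-dec_; _→-dec_; ¬?; map′; decidable-stable)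
open import Relation.Binary.PropositionalEquality using (_≡_; _≢_; refl; sym; trans; cong; subst)

-- Counting vertices through covering lists

covering⇒≤length : ∀ {m} (xs : List (Fin m)) → (∀ x → x ∈ xs) → m ≤ length xs
covering⇒≤length xs cover = injective⇒≤ {f = index ∘ cover} λ {x} {y} eq →
  trans (lookup-index (cover x))
        (trans (cong (lookup xs) eq) (sym (lookup-index (cover y))))

length-concatMap≤ : ∀ {A : Set} (L : A → List A) (f : A → ℕ) →
  (∀ v → length (L v) ≤ 3 * f v) →
  ∀ xs → length (concatMap L xs) ≤ 3 * sum (map f xs)
length-concatMap≤ L f short []       = z≤n
length-concatMap≤ L f short (x ∷ xs) = begin
  length (L x ++ concatMap L xs)         ≡⟨ length-++ (L x) ⟩
  length (L x) + length (concatMap L xs) ≤⟨ ℕ.+-mono-≤ (short x) (length-concatMap≤ L f short xs) ⟩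
  3 * f x + 3 * sum (map f xs)           ≡⟨ ℕ.*-distribˡ-+ 3 (f x) _ ⟨
  3 * sum (map f (x ∷ xs))               ∎
  where open ℕ.≤-Reasoning

≤3*⇒ceil/3≤ : ∀ {m c} → m ≤ 3 * c → ceil/3 m ≤ c
≤3*⇒ceil/3≤ {m} {c} m≤3c = s≤s⁻¹ (m<n*o⇒m/o<n {n = suc c} (begin-strict
  m + 2     ≤⟨ ℕ.+-monoˡ-≤ 2 m≤3c ⟩
  3 * c + 2 <⟨ ℕ.n<1+n _ ⟩
  suc (3 * c + 2) ≡⟨ solve 1 (λ c → con 1 :+ (con 3 :* c :+ con 2) := con 3 :+ c :* con 3) refl c ⟩
  suc c * 3 ∎))
  where
  open ℕ.≤-Reasoning
  open +-*-Solver

-- Broadcasts in an arbitrary graph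

module _ {G : Graph} where

  Reach-mono : ∀ {j k u v} → j ≤ k → Reach G j u v → Reach G k u v
  Reach-mono _         here       = here
  Reach-mono (s≤s j≤k) (step a r) = step a (Reach-mono j≤k r)

  Reach-zero : ∀ {u v} → Reach G 0 u v → u ≡ v
  Reach-zero here = refl

  InH-mono : ∀ {j k u v} → j ≤ k → 0 < j × Reach G j u v → 0 < k × Reach G k u v
  InH-mono j≤k (pos , r) = ≤-trans pos j≤k , Reach-mono j≤k r

  InPB⇒InPN : ∀ {f v u} → InPB G f v u → InPN G f v u
  InPB⇒InPN (inj₁ ((_ , single) , u≡v)) = proj₂ (single _) u≡v
  InPB⇒InPN (inj₂ (_ , pn , _))         = pn

  -- Both lower bounds are instances: `L v` lists the slots paid for by `v`, at most three per unit
  -- of strength, and repetitions do no harm.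
  covering⇒ceil/3≤cost : ∀ (f : V G → ℕ) (L : V G → List (V G)) →
    (∀ v → length (L v) ≤ 3 * f v) → (∀ x → ∃ λ v → x ∈ L v) →
    ceil/3 (n G) ≤ cost G f
  covering⇒ceil/3≤cost f L short cover = ≤3*⇒ceil/3≤ (≤-trans
    (covering⇒≤length (concatMap L (allFin _)) λ x →
      ∈-concatMap⁺ L (lose (∈-allFin (proj₁ (cover x))) (proj₂ (cover x))))
    (length-concatMap≤ L f short (allFin _)))

  -- Suppose `f v < g v` and let `u` be a boundary vertex of `v` under `g`. Whatever dominates `u`
  -- under `f` still does so under `g`, so by privacy it is `v`. Then `u` is within `f v` of `v`,
  -- too close for the boundary; in the exceptional case `f v` would be positive and below 1.
  dominating∧irredundant⇒maximal : ∀ {f} →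
    IsDominating G f → IsIrredundant G f → IsMaximalIrredundant G f
  dominating∧irredundant⇒maximal {f} (_ , dom) irr = irr , λ g (_ , g-pb) f≤g v →
    [ (λ f<g → contradiction (g-pb v (≤-trans (s≤s z≤n) f<g))
                             λ (u , pb) → absurd g f≤g f<g pb)
    , sym ]′ (m≤n⇒m<n∨m≡n (f≤g v))
    where
    absurd : ∀ g → (∀ v → f v ≤ g v) → ∀ {v u} → f v < g v → ¬ InPB G g v u
    absurd g f≤g {v} f<g (inj₁ ((gv≡1 , single) , refl)) with dom v
    ... | w , hw@(pos , _) with proj₂ (proj₂ (single v) refl) w (InH-mono (f≤g w) hw)
    ... | refl = ℕ.<⇒≱ f<g (subst (_≤ f v) (sym gv≡1) pos)
    absurd g f≤g {v} {u} f<g (inj₂ (_ , (_ , only) , (_ , far))) with dom u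
    ... | w , hw with only w (InH-mono (f≤g w) hw)
    ... | refl = far (f v) f<g (proj₂ hw)

-- Decidability, and raising one value of a maximal irredundant broadcast

DecidableAdj : Graph → Set
DecidableAdj G = ∀ u w → Dec (Adj G u w)

module _ {G : Graph} (adj? : DecidableAdj G) where

  abstract

    -- Finite search stands in for excluded middle: the arguments by contradiction below rest on
    -- these decision procedures.
    Reach? : ∀ k u v → Dec (Reach G k u v)
    Reach? zero    u v = map′ (λ { refl → here }) Reach-zero (u ≟ v)
    Reach? (suc k) u v = map′
      (λ { (inj₁ refl) → here ; (inj₂ (_ , a , r)) → step a r })
      (λ { here → inj₁ refl ; (step a r) → inj₂ (_ , a , r) })
      (u ≟ v ⊎-dec any? λ w → adj? u w ×-dec Reach? k w v)

    InH? : ∀ f u v → Dec (InH G f u v)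
    InH? f u v = 0 <? f v ×-dec Reach? (f v) u v

    InPN? : ∀ f v u → Dec (InPN G f v u)
    InPN? f v u = InH? f u v ×-dec all? λ w → InH? f u w →-dec w ≟ v

    PNSingleton? : ∀ f v → Dec (PNSingleton G f v)
    PNSingleton? f v = all? λ u → (InPN? f v u →-dec u ≟ v) ×-dec (u ≟ v →-dec InPN? f v u)

    DistEq? : ∀ k u v → Dec (DistEq G k u v)
    DistEq? k u v = Reach? k u v ×-dec
      map′ (λ far j j<k → far j<k) (λ far {j} → far j) (ℕ.allUpTo? (λ j → ¬? (Reach? j u v)) k)

    lone? : ∀ f v → Dec (f v ≡ 1 × PNSingleton G f v)
    lone? f v = f v ℕ.≟ 1 ×-dec PNSingleton? f v

    InPB? : ∀ f v u → Dec (InPB G f v u)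
    InPB? f v u = (lone? f v ×-dec u ≟ v)
      ⊎-dec (¬? (lone? f v) ×-dec InPN? f v u ×-dec DistEq? (f v) u v)

  raise : (V G → ℕ) → V G → ℕ → V G → ℕ
  raise f v m = updateAt f v (const m)

  module _ {f : V G → ℕ} (max : IsMaximalIrredundant G f) (v : V G) (m : ℕ) (fv<m : f v < m) where

    raise-at : raise f v m v ≡ m
    raise-at = updateAt-updates v f

    private
      g : V G → ℕ
      g = raise f v m

      g≡f : ∀ {w} → w ≢ v → g w ≡ f w
      g≡f {w} = updateAt-minimal w v f

      f≤g : ∀ w → f w ≤ g w
      f≤g w with w ≟ v
      ... | yes refl = ≤-trans (ℕ.<⇒≤ fv<m) (≤-reflexive (sym raise-at))
      ... | no w≢v   = ≤-reflexive (sym (g≡f w≢v))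

      H-reflect : ∀ {u w} → w ≢ v → InH G g u w → InH G f u w
      H-reflect {u} {w} w≢v = InH-mono (≤-reflexive (g≡f w≢v))

      H-at-v : ∀ {u} → InH G g u v → Reach G m u v
      H-at-v (_ , r) = subst (λ k → Reach G k _ v) raise-at r

      PN-survives : ∀ {w q} → InPN G f w q → ¬ Reach G m q v → InPN G g w q
      PN-survives {w} {q} (h , only) far = InH-mono (f≤g w) h , only′
        where
        only′ : ∀ z → InH G g q z → z ≡ w
        only′ z hz with z ≟ v
        ... | yes refl = contradiction (H-at-v hz) far
        ... | no z≢v   = only z (H-reflect z≢v hz)

      PN-reflects : ∀ {w q} → w ≢ v → InPN G g w q → InPN G f w q
      PN-reflects w≢v (h , only) = H-reflect w≢v h , λ z hz → only z (InH-mono (f≤g z) hz)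

      -- A vertex outside the new ball around `v` hears nothing new, so it stays private to `w`. In
      -- the exceptional case the private neighbourhood of `w` cannot grow beyond `w`, since `g`
      -- only adds hearers.
      PB-survives : ∀ {w q} → w ≢ v → InPB G f w q → ¬ Reach G m q v → ∃ (InPB G g w)
      PB-survives {w} w≢v pb@(inj₁ ((fw≡1 , single) , refl)) far =
        w , inj₁ ((trans (g≡f w≢v) fw≡1 , λ t →
              (λ pn → proj₁ (single t) (PN-reflects w≢v pn)) ,
              λ { refl → PN-survives (InPB⇒InPN {f = f} pb) far }) , refl)
      PB-survives {w} {q} w≢v (inj₂ (_ , pn , dist)) far with lone? g w
      -- This case need not be refuted: a lone `w` is its own boundary vertex.
      ... | yes lone = w , inj₁ (lone , refl)
      ... | no ¬lone = q , inj₂ (¬lone , PN-survives pn far ,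
                                 subst (λ k → DistEq G k q w) (sym (g≡f w≢v)) dist)

    raise-private : ∀ {u} → (∀ w → ¬ InH G f u w) → Reach G m u v → InPN G (raise f v m) v u
    raise-private {u} undom r = subst (λ k → 0 < k × Reach G k u v) (sym raise-at)
        (≤-trans (s≤s z≤n) fv<m , r) , only
      where
      only : ∀ z → InH G g u z → z ≡ v
      only z hz = decidable-stable (z ≟ v) λ z≢v → undom z (H-reflect z≢v hz)

    abstract

      -- By maximality some other w loses its private boundary, which is possible
      -- only if the new ball around v swallows it.
      raise-destroys :
        (∃ λ u → DistGe G m v u) → ∃ (InPB G (raise f v m) v) →
        ∃ λ w → w ≢ v × 0 < f w × (∀ q → InPB G f w q → Reach G m q v)
      raise-destroys far v-pb = w , w≢v , subst (0 <_) (g≡f w≢v) 0<gw , λ q pb →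
        decidable-stable (Reach? m q v) λ ¬r → no-pb (PB-survives w≢v pb ¬r)
        where
        Sound : V G → Set
        Sound w = 0 < g w → ∃ (InPB G g w)

        g-broadcast : IsBroadcast G g
        g-broadcast w with w ≟ v
        ... | yes refl = subst (λ k → ∃ λ u → DistGe G k v u) (sym raise-at) far
        ... | no w≢v   = subst (λ k → ∃ λ u → DistGe G k w u) (sym (g≡f w≢v)) (proj₁ (proj₁ max) w)

        unsound : ∃ λ w → ¬ Sound w
        unsound = ¬∀⟶∃¬ _ Sound (λ w → (0 <? g w) →-dec any? (InPB? g w)) λ sound →
          ℕ.<⇒≢ fv<m (trans (sym (proj₂ max g (g-broadcast , sound) f≤g v)) raise-at)

        w : V G
        w = proj₁ unsound

        no-pb : ¬ ∃ (InPB G g w)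
        no-pb pb = proj₂ unsound (const pb)

        0<gw : 0 < g w
        0<gw = decidable-stable (0 <? g w) λ ¬pos → proj₂ unsound λ pos → contradiction pos ¬pos

        w≢v : w ≢ v
        w≢v w≡v = no-pb (subst (λ z → ∃ (InPB G g z)) (sym w≡v) v-pb)

-- Rotations and their balls

infixr 9 _^_

_^_ : {A : Set} → (A → A) → ℕ → A → A
(f ^ zero)  x = x
(f ^ suc k) x = f ((f ^ k) x)

^-suc : ∀ {A : Set} (f : A → A) k x → (f ^ suc k) x ≡ (f ^ k) (f x)
^-suc f zero    x = refl
^-suc f (suc k) x = cong f (^-suc f k x)

^-+ : ∀ {A : Set} (f : A → A) j k x → (f ^ (j + k)) x ≡ (f ^ j) ((f ^ k) x)
^-+ f zero    k x = refl
^-+ f (suc j) k x = cong f (^-+ f j k x)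

-- The lower bounds see a cycle only through its two inverse unit steps; powers of `S` and `P` wrap
-- around by themselves, without modular arithmetic. `P-moves` excludes loops.
record Rotation (G : Graph) : Set where
  field
    S P     : V G → V G
    S∘P     : ∀ x → S (P x) ≡ x
    P∘S     : ∀ x → P (S x) ≡ x
    adj-S   : ∀ x → Adj G x (S x)
    adj-P   : ∀ x → Adj G x (P x)
    adj-inv : ∀ {x y} → Adj G x y → y ≡ S x ⊎ y ≡ P x
    P-moves : ∀ x → P x ≢ x

  S-moves : ∀ x → S x ≢ x
  S-moves x Sx≡x = P-moves x (trans (cong P (sym Sx≡x)) (P∘S x))

  S^P^ : ∀ k x → (S ^ k) ((P ^ k) x) ≡ x
  S^P^ zero    x = refl
  S^P^ (suc k) x = trans (^-suc S k _) (trans (cong (S ^ k) (S∘P _)) (S^P^ k x))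

  -- The metric ball, by `Reach⇒Ball` and `Ball⇒Reach`. Because of wrap-around, the `j` and the
  -- direction need not be unique.
  Ball : ℕ → V G → V G → Set
  Ball k v x = ∃ λ j → j ≤ k × (x ≡ (S ^ j) v ⊎ x ≡ (P ^ j) v)

  Ball-mono : ∀ {j k v x} → j ≤ k → Ball j v x → Ball k v x
  Ball-mono j≤k (i , i≤j , at) = i , ≤-trans i≤j j≤k , at

  -- The net displacement is `a - b`; the two hypotheses bound its absolute value by `k` without
  -- subtraction. Opposite steps cancel in pairs.
  Ball-S^P^ : ∀ {k} a b w → a ≤ k + b → b ≤ k + a → Ball k w ((S ^ a) ((P ^ b) w))
  Ball-S^P^ zero b w _ b≤ = b , subst (b ≤_) (ℕ.+-identityʳ _) b≤ , inj₂ refl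
  Ball-S^P^ (suc a) zero w a≤ _ = suc a , subst (suc a ≤_) (ℕ.+-identityʳ _) a≤ , inj₁ refl
  Ball-S^P^ {k} (suc a) (suc b) w a≤ b≤ = subst (Ball k w)
    (sym (trans (^-suc S a _) (cong (S ^ a) (S∘P _))))
    (Ball-S^P^ a b w (s≤s⁻¹ (subst (suc a ≤_) (ℕ.+-suc k b) a≤))
                     (s≤s⁻¹ (subst (suc b ≤_) (ℕ.+-suc k a) b≤)))

  Ball-S : ∀ {k v x} → Ball k v x → Ball (suc k) v (S x)
  Ball-S (j     , j≤k , inj₁ refl) = suc j , s≤s j≤k , inj₁ refl
  Ball-S (zero  , j≤k , inj₂ refl) = 1 , s≤s z≤n , inj₁ refl
  Ball-S (suc j , j≤k , inj₂ refl) = j , ≤-trans (ℕ.n≤1+n j) (ℕ.m≤n⇒m≤1+n j≤k) , inj₂ (S∘P _)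

  S∘P^-inner : ∀ {k v} → 0 < k → Ball (k ∸ 1) v (S ((P ^ k) v))
  S∘P^-inner {suc k} _ = k , ≤-refl , inj₂ (S∘P _)

  reach-S^ : ∀ j v → Reach G j ((S ^ j) v) v
  reach-S^ zero    v = here
  reach-S^ (suc j) v =
    step (adj-P _) (subst (λ x → Reach G j x v) (sym (P∘S _)) (reach-S^ j v))

  boundary : ∀ {k v x} → Ball k v x → (∀ j → j < k → ¬ Ball j v x) →
             x ≡ (S ^ k) v ⊎ x ≡ (P ^ k) v
  boundary (j , j≤k , at) far with m≤n⇒m<n∨m≡n j≤k
  ... | inj₁ j<k  = contradiction (j , ≤-refl , at) (far j j<k)
  ... | inj₂ refl = at

-- Reversing the orientation turns every lemma about the `S` end of a ball into one about its `P`
-- end.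
mirror : ∀ {G} → Rotation G → Rotation G
mirror R = record
  { S = P ; P = S ; S∘P = P∘S ; P∘S = S∘P ; adj-S = adj-P ; adj-P = adj-S
  ; adj-inv = [ inj₂ , inj₁ ]′ ∘ adj-inv ; P-moves = S-moves }
  where open Rotation R

module _ {G : Graph} (R : Rotation G) where
  open Rotation R

  Ball-mirror : ∀ {k v x} → Ball k v x → Rotation.Ball (mirror R) k v x
  Ball-mirror (j , j≤k , at) = j , j≤k , [ inj₂ , inj₁ ]′ at

Ball-P : ∀ {G} (R : Rotation G) → let open Rotation R in
         ∀ {k v x} → Ball k v x → Ball (suc k) v (P x)
Ball-P R {v = v} b = Ball-mirror (mirror R) {v = v} (Rotation.Ball-S (mirror R) (Ball-mirror R {v = v} b))

module _ {G : Graph} (R : Rotation G) where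
  open Rotation R

  Reach⇒Ball : ∀ {k x v} → Reach G k x v → Ball k v x
  Reach⇒Ball here = 0 , z≤n , inj₁ refl
  Reach⇒Ball {v = v} (step {k = k} {u = u} a r) with adj-inv a
  ... | inj₁ refl = subst (Ball (suc k) v) (P∘S u) (Ball-P R (Reach⇒Ball r))
  ... | inj₂ refl = subst (Ball (suc k) v) (S∘P u) (Ball-S (Reach⇒Ball r))

  Ball⇒Reach : ∀ {k x v} → Ball k v x → Reach G k x v
  Ball⇒Reach (j , j≤k , inj₁ refl) = Reach-mono j≤k (reach-S^ j _)
  Ball⇒Reach (j , j≤k , inj₂ refl) = Reach-mono j≤k (Rotation.reach-S^ (mirror R) j _)

  Reach-sym : ∀ {k x y} → Reach G k x y → Reach G k y x
  Reach-sym {y = y} r with Reach⇒Ball r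
  ... | j , j≤k , inj₁ refl =
    Ball⇒Reach (j , j≤k , inj₂ (sym (Rotation.S^P^ (mirror R) j y)))
  ... | j , j≤k , inj₂ refl = Ball⇒Reach (j , j≤k , inj₁ (sym (S^P^ j y)))

  sphere : ∀ {k x v} → DistEq G k x v → x ≡ (S ^ k) v ⊎ x ≡ (P ^ k) v
  sphere (r , far) = boundary (Reach⇒Ball r) λ j j<k b → far j j<k (Ball⇒Reach b)

  -- Entries repeat once the ball wraps around; only an upper bound on the count is wanted.
  ballList : ℕ → V G → List (V G)
  ballList zero    v = v ∷ []
  ballList (suc k) v = (S ^ suc k) v ∷ (P ^ suc k) v ∷ ballList k v

  length-ballList : ∀ k v → length (ballList k v) ≡ 1 + (k + k)
  length-ballList zero    v = refl
  length-ballList (suc k) v = cong (2 +_) (trans (length-ballList k v) (sym (ℕ.+-suc k k)))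

  ∈-ballList : ∀ k {v x} → Ball k v x → x ∈ ballList k v
  ∈-ballList zero    (zero , z≤n , inj₁ refl) = here refl
  ∈-ballList zero    (zero , z≤n , inj₂ refl) = here refl
  ∈-ballList (suc k) (j , j≤1+k , at) with m≤n⇒m<n∨m≡n j≤1+k | at
  ... | inj₁ (s≤s j≤k) | _         = there (there (∈-ballList k (j , j≤k , at)))
  ... | inj₂ refl      | inj₁ refl = here refl
  ... | inj₂ refl      | inj₂ refl = there (here refl)

  dominating⇒ceil/3≤cost : ∀ f → IsDominating G f → ceil/3 (n G) ≤ cost G f
  dominating⇒ceil/3≤cost f (_ , dom) = covering⇒ceil/3≤cost {G} f (λ v → balls v (f v)) (λ v → short v (f v))
    λ x → let v , (pos , r) = dom x in v , ∈-balls (f v) pos (Reach⇒Ball r)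
    where
    balls : V G → ℕ → List (V G)
    -- Strength 0 dominates nothing, and the bound `3 * 0` leaves no room for the centre.
    balls v zero      = []
    balls v k@(suc _) = ballList k v

    short : ∀ v k → length (balls v k) ≤ 3 * k
    short v zero      = z≤n
    short v k@(suc j) = begin
      length (ballList k v) ≡⟨ length-ballList k v ⟩
      1 + (k + k)           ≤⟨ ℕ.+-monoˡ-≤ (k + k) (s≤s z≤n) ⟩
      k + (k + k)           ≡⟨ cong (λ i → k + (k + i)) (ℕ.+-identityʳ k) ⟨
      3 * k                 ∎
      where open ℕ.≤-Reasoning

    ∈-balls : ∀ k {v x} → 0 < k → Ball k v x → x ∈ balls v k
    ∈-balls (suc k) _ = ∈-ballList (suc k)

-- Slots of a maximal irredundant broadcast

module _ {G : Graph} (adj? : DecidableAdj G) {f : V G → ℕ} (max : IsMaximalIrredundant G f) where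

  Undominated : V G → Set
  Undominated x = ∀ v → ¬ InH G f x v

  private
    pb-exists : ∀ v → 0 < f v → ∃ (InPB G f v)
    pb-exists = proj₂ (proj₁ max)

  module _ (R : Rotation G) where
    open Rotation R

    Ball⇒InH : ∀ {v x} → 0 < f v → Ball (f v) v x → InH G f x v
    Ball⇒InH {v} pos b = pos , Ball⇒Reach R {v = v} b

    abstract

      -- This is `raise-destroys` for `u` raised from 0 to 1. The vertex `u` becomes private to
      -- itself, which secures it a boundary.
      undominated-destroys : ∀ {u} → Undominated u →
        ∃ λ w → 0 < f w × (∀ q → InPB G f w q → Reach G 1 q u)
      undominated-destroys {u} undom =
        let w , _ , pos , near = raise-destroys adj? max u 1 fu<1 (S u , far) own-pb
        in  w , pos , near
        where
        g : V G → ℕ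
        g = raise adj? f u 1

        fu<1 : f u < 1
        fu<1 = ℕ.≰⇒> λ pos → undom u (pos , here)

        gu≡1 : g u ≡ 1
        gu≡1 = raise-at adj? max u 1 fu<1

        far : DistGe G 1 u (S u)
        far zero    _        r = S-moves u (sym (Reach-zero r))
        far (suc _) (s≤s ()) _

        own-pb : ∃ (InPB G g u)
        -- A private vertex other than `u` is at distance 1 and serves as boundary; if there is
        -- none, the exceptional clause for strength 1 makes `u` its own boundary.
        own-pb with any? (λ t → InPN? adj? g u t ×-dec ¬? (t ≟ u))
        ... | yes (t , pn , t≢u) = t , inj₂
                ( (λ (_ , single) → t≢u (proj₁ (single t) pn)) , pn , proj₂ (proj₁ pn)
                , λ { j j<gu r → t≢u (Reach-zero (Reach-mono (s≤s⁻¹ (subst (j <_) gu≡1 j<gu)) r)) })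
        ... | no none = u , inj₁ ((gu≡1 , λ t →
                (λ pn → decidable-stable (t ≟ u) λ t≢u → none (t , pn , t≢u)) ,
                λ { refl → raise-private adj? max u 1 fu<1 undom here }) , refl)

      -- With strength `suc (f v)`, `v` has the undominated vertex as its boundary, so another `w`
      -- loses its own. Each boundary vertex of `w` is within the new radius of `v` but, being
      -- private to `w`, not within the old one. It is therefore at one of the two new ends, and the
      -- `S` end is undominated.
      growth-destroys : ∀ {v} → 0 < f v → Undominated ((S ^ suc (f v)) v) →
        ∃ λ w → w ≢ v × 0 < f w × (∀ q → InPB G f w q → q ≡ (P ^ suc (f v)) v)
      growth-destroys {v} pos undom =
        let w , w≢v , pos-w , near = raise-destroys adj? max v m ≤-refl (u , far) own-pb
        in  w , w≢v , pos-w , λ q pb → on-far-side w≢v (InPB⇒InPN {f = f} pb) (near q pb)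
        where
        m : ℕ
        m = suc (f v)

        u : V G
        u = (S ^ m) v

        far′ : DistGe G m u v
        far′ j j<m r = undom v (pos , Reach-mono (s≤s⁻¹ j<m) r)

        far : DistGe G m v u
        far j j<m r = far′ j j<m (Reach-sym R r)

        gv≡m : raise adj? f v m v ≡ m
        gv≡m = raise-at adj? max v m ≤-refl

        own-pb : ∃ (InPB G (raise adj? f v m) v)
        own-pb = u , inj₂
          ( (λ (gv≡1 , _) → ℕ.<⇒≢ pos (sym (ℕ.suc-injective (trans (sym gv≡m) gv≡1))))
          , raise-private adj? max v m ≤-refl undom (reach-S^ m v)
          , subst (λ k → DistEq G k u v) (sym gv≡m) (reach-S^ m v , far′))

        on-far-side : ∀ {w q} → w ≢ v → InPN G f w q → Reach G m q v → q ≡ (P ^ m) v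
        on-far-side {w} {q} w≢v (h , only) r
          with sphere R (r , λ j j<m r′ → w≢v (sym (only v (pos , Reach-mono (s≤s⁻¹ j<m) r′))))
        ... | inj₁ q≡u = contradiction (subst (λ x → InH G f x w) q≡u h) (undom w)
        ... | inj₂ q≡  = q≡

    -- v hands its slot P^f v, dominated by someone else, over to the undominated S^(f+1) v.
    Redirected : V G → Set
    Redirected v = InPN G f v ((S ^ f v) v) × ¬ InPN G f v ((P ^ f v) v) × Undominated ((S ^ suc (f v)) v)

    redirected? : ∀ v → Dec (Redirected v)
    redirected? v = InPN? adj? f v _ ×-dec ¬? (InPN? adj? f v _) ×-dec all? λ w → ¬? (InH? adj? f _ w)

    -- The end slot on the `P` side after redirection; `mirror R` gives the `S` side. The relational
    -- form allows reasoning by cases without evaluating `redirected?` inside `endpoint`.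
    EndSlot : V G → V G → Set
    EndSlot v x = (x ≡ (P ^ f v) v × ¬ Redirected v) ⊎ (x ≡ (S ^ suc (f v)) v × Redirected v)

    endpoint : ∀ v → V G
    endpoint v with redirected? v
    ... | yes _ = (S ^ suc (f v)) v
    ... | no _  = (P ^ f v) v

    EndSlot⇒≡endpoint : ∀ {v x} → EndSlot v x → x ≡ endpoint v
    EndSlot⇒≡endpoint {v} slot with redirected? v | slot
    ... | yes r | inj₁ (_ , ¬r) = contradiction r ¬r
    ... | yes _ | inj₂ (eq , _) = eq
    ... | no _  | inj₁ (eq , _) = eq
    ... | no ¬r | inj₂ (_ , r)  = contradiction r ¬r

    -- Going `f v + f v` steps from the common `P` end reaches the `S` end of `v` without leaving
    -- the ball of `w`. That end is private to `v`.
    nested-ends : ∀ {v w} → 0 < f w → f v ≤ f w → (P ^ f v) v ≡ (P ^ f w) w →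
                  InPN G f v ((S ^ f v) v) → v ≡ w
    nested-ends {v} {w} pos fv≤fw ends (_ , only) = sym (only w (Ball⇒InH pos
      (subst (Ball (f w) w) eq
        (Ball-S^P^ (f v + f v) (f w) w (ℕ.+-mono-≤ fv≤fw fv≤fw) (ℕ.m≤m+n (f w) _)))))
      where
      eq : (S ^ (f v + f v)) ((P ^ f w) w) ≡ (S ^ f v) v
      eq = trans (cong (S ^ (f v + f v)) (sym ends))
                 (trans (^-+ S (f v) (f v) _) (cong (S ^ f v) (S^P^ (f v) v)))

    redirected-unique : ∀ {v w} → 0 < f v → 0 < f w → (P ^ f v) v ≡ (P ^ f w) w →
                        Redirected v → Redirected w → v ≡ w
    redirected-unique {v} {w} pos-v pos-w ends (pn-v , _) (pn-w , _) with ℕ.≤-total (f v) (f w)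
    ... | inj₁ le = nested-ends pos-w le ends pn-v
    ... | inj₂ ge = sym (nested-ends pos-v ge (sym ends) pn-w)

    -- A walk of length `i < f v` to the `P` end would close up a short cycle. Modulo it, the
    -- `suc (f v)` steps to the undominated vertex amount to a displacement of `1 - i` or `1 + i`,
    -- so `v` would dominate that vertex.
    antipode-far : ∀ {v} → 0 < f v → Undominated ((S ^ suc (f v)) v) → DistGe G (f v) ((P ^ f v) v) v
    antipode-far {v} pos undom j j<k r with Reach⇒Ball R r
    ... | i , i≤j , inj₁ P^≡S^ = undom v (Ball⇒InH pos (subst (Ball k v)
            (cong (S ^ suc k) v≡)
            (Ball-S^P^ (suc k) (i + k) v
              (≤-trans (ℕ.+-monoˡ-≤ k pos) (ℕ.+-monoʳ-≤ k (ℕ.m≤n+m k i)))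
              (≤-trans (ℕ.+-monoˡ-≤ k (ℕ.<⇒≤ (ℕ.≤-<-trans i≤j j<k))) (ℕ.+-monoʳ-≤ k (ℕ.n≤1+n k))))))
      where
      k : ℕ
      k = f v
      v≡ : (P ^ (i + k)) v ≡ v
      v≡ = trans (^-+ P i k v) (trans (cong (P ^ i) P^≡S^) (Rotation.S^P^ (mirror R) i v))
    ... | i , i≤j , inj₂ P^≡P^ = undom v (Ball⇒InH pos (subst (Ball k v)
            (trans (^-+ S (suc k) i _) (cong (S ^ suc k) v≡))
            (Ball-S^P^ (suc k + i) k v
              (subst (_≤ k + k) (ℕ.+-suc k i) (ℕ.+-monoʳ-≤ k (ℕ.≤-<-trans i≤j j<k)))
              (ℕ.m≤m+n k _))))
      where
      k : ℕ
      k = f v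
      v≡ : (S ^ i) ((P ^ k) v) ≡ v
      v≡ = trans (cong (S ^ i) P^≡P^) (S^P^ i v)

    -- Of the vertices within distance 1 of the end, the end itself and its inner neighbour are
    -- dominated by `w`.
    outer-neighbour : ∀ {u w} → 0 < f w → Undominated u →
      Reach G 1 ((S ^ f w) w) u → u ≡ (S ^ suc (f w)) w
    outer-neighbour {w = w} pos undom here =
      contradiction (Ball⇒InH pos (f w , ≤-refl , inj₁ refl)) (undom w)
    outer-neighbour {w = w} pos undom (step a here) with adj-inv a
    ... | inj₁ eq   = eq
    ... | inj₂ refl = contradiction
      (Ball⇒InH pos (Ball-mono {v = w} (ℕ.m∸n≤m (f w) 1)
        (Ball-mirror (mirror R) {v = w} (Rotation.S∘P^-inner (mirror R) pos))))
      (undom w)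

  -- Occupation of one of the `2 * f v + 1` slots: the ball of radius `f v ∸ 1` supplies all but the
  -- two ends.
  Hit : Rotation G → V G → Set
  Hit R x = ∃ λ v → 0 < f v ×
    (Rotation.Ball R (f v ∸ 1) v x ⊎ EndSlot R v x ⊎ EndSlot (mirror R) v x)

  Hit-mirror : ∀ R {x} → Hit (mirror R) x → Hit R x
  Hit-mirror R (v , pos , inj₁ b)        = v , pos , inj₁ (Ball-mirror (mirror R) {v = v} b)
  Hit-mirror R (v , pos , inj₂ (inj₁ e)) = v , pos , inj₂ (inj₂ e)
  Hit-mirror R (v , pos , inj₂ (inj₂ e)) = v , pos , inj₂ (inj₁ e)

  module _ (R : Rotation G) where
    open Rotation R

    -- If the `P` end of `w` is not private, `w` redirects that slot to `u`. If it is, it is a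
    -- boundary vertex too, so `u` is next to both ends; the vertex destroyed by growing `w` would
    -- then have its boundary at the undominated `u`.
    adjacent-boundary-hit : ∀ {u w} → 0 < f w → Undominated u →
      ¬ (f w ≡ 1 × PNSingleton G f w) → InPN G f w ((S ^ f w) w) →
      (∀ q → InPB G f w q → Reach G 1 q u) → Reach G 1 ((S ^ f w) w) u → Hit R u
    adjacent-boundary-hit {u} {w} pos undom ¬lone pn near r
      with outer-neighbour R pos undom r | InPN? adj? f w ((P ^ f w) w)
    ... | refl | no ¬pn = w , pos , inj₂ (inj₁ (inj₂ (refl , pn , ¬pn , undom)))
    ... | refl | yes pn′ = contradiction (proj₁ (InPB⇒InPN {f = f} (proj₂ w′-pb))) λ h →
            undom w′ (subst (λ x → InH G f x w′) (trans (all-far _ (proj₂ w′-pb)) (sym antipodal)) h)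
      where
      antipode-pb : InPB G f w ((P ^ f w) w)
      antipode-pb = inj₂ (¬lone , pn′ , proj₂ (proj₁ pn′) , antipode-far R pos undom)

      antipodal : u ≡ (P ^ suc (f w)) w
      antipodal = outer-neighbour (mirror R) pos undom (near _ antipode-pb)

      grown = growth-destroys R pos undom
      w′ = proj₁ grown
      w′-pb = pb-exists w′ (proj₁ (proj₂ (proj₂ grown)))
      all-far = proj₂ (proj₂ (proj₂ grown))

  undominated-hit : ∀ R {u} → Undominated u → Hit R u
  undominated-hit R {u} undom with undominated-destroys R undom
  ... | w , pos , near with pb-exists w pos
  -- Here `w` is its own boundary vertex, hence within 1 of `u`, and already dominates it.
  ... | q , pb@(inj₁ ((fw≡1 , _) , refl)) = contradiction
        (pos , Reach-mono pos (Reach-sym R (near w pb))) (undom w)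
  ... | q , pb@(inj₂ (¬lone , pn , dist)) with sphere R dist
  ... | inj₁ refl = adjacent-boundary-hit R pos undom ¬lone pn near (near q pb)
  ... | inj₂ refl = Hit-mirror R
        (adjacent-boundary-hit (mirror R) pos undom ¬lone pn near (near q pb))

  hit⊎redirected : ∀ R {v k} → let open Rotation R in 0 < f v → k ≤ f v →
    Hit R ((P ^ k) v) ⊎ (k ≡ f v × Redirected R v)
  hit⊎redirected R {v} {k} pos k≤ with m≤n⇒m<n∨m≡n k≤ | redirected? R v
  ... | inj₁ k<  | _      = inj₁ (v , pos , inj₁ (k , ℕ.≤-pred (subst (suc k ≤_) (sym (ℕ.m+[n∸m]≡n pos)) k<) , inj₂ refl))
  ... | inj₂ k≡f | yes r  = inj₂ (k≡f , r)
  ... | inj₂ refl | no ¬r = inj₁ (v , pos , inj₂ (inj₁ (inj₁ (refl , ¬r))))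

  dominated-hit : ∀ R {v x} → let open Rotation R in InH G f x v →
    Hit R x ⊎ (x ≡ (P ^ f v) v × Redirected R v) ⊎ (x ≡ (S ^ f v) v × Redirected (mirror R) v)
  dominated-hit R {v} (pos , r) with Reach⇒Ball R r
  ... | k , k≤ , inj₂ refl with hit⊎redirected R pos k≤
  ...   | inj₁ hit        = inj₁ hit
  ...   | inj₂ (refl , d) = inj₂ (inj₁ (refl , d))
  dominated-hit R {v} (pos , r) | k , k≤ , inj₁ refl with hit⊎redirected (mirror R) pos k≤
  ...   | inj₁ hit        = inj₁ (Hit-mirror R hit)
  ...   | inj₂ (refl , d) = inj₂ (inj₂ (refl , d))

  -- Since `x` is not private to `v`, another vertex dominates it. That vertex fails to offer a slot
  -- only if it has redirected `x` itself: at its `P` end `redirected-unique` forbids this, and at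
  -- its `S` end the boundary of `w` at `P x` does.
  redirected-hit : ∀ R {v} → let open Rotation R in
    0 < f v → Redirected R v → Hit R ((P ^ f v) v)
  redirected-hit R {v} pos red@(pn , ¬pn , undom) = by-cases
    where
    open Rotation R
    x = (P ^ f v) v

    grown = growth-destroys R pos undom
    w = proj₁ grown
    w≢v = proj₁ (proj₂ grown)
    pos-w = proj₁ (proj₂ (proj₂ grown))

    pb : InPB G f w (P x)
    pb with pb-exists w pos-w
    ... | q , pb = subst (InPB G f w) (proj₂ (proj₂ (proj₂ grown)) q pb) pb

    Px-private : InPN G f w (P x)
    Px-private = InPB⇒InPN {f = f} pb

    dominates-Px : ∀ {z} → 0 < f z → x ≡ (S ^ f z) z → Ball (f z ∸ 1) z (P x)
    dominates-Px {z} pos-z eq = subst (λ y → Ball (f z ∸ 1) z (P y)) (sym eq)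
      (Ball-mirror (mirror R) {v = z} (Rotation.S∘P^-inner (mirror R) pos-z))

    hit-by : ∀ {z} → z ≢ v → InH G f x z → (x ≡ (S ^ f z) z → ¬ Redirected (mirror R) z) → Hit R x
    hit-by {z} z≢v hz not-S with dominated-hit R hz
    ... | inj₁ hit               = hit
    ... | inj₂ (inj₁ (eq , red′)) = contradiction (redirected-unique R (proj₁ hz) pos (sym eq) red′ red) z≢v
    ... | inj₂ (inj₂ (eq , red′)) = contradiction red′ (not-S eq)

    -- Otherwise `P x` is one step inside the ball of `w`, too close for a boundary vertex. In the
    -- exceptional case, redirection makes `P w` private to the lone `w`, forcing `P w` to equal
    -- `w`.
    w-not-S : x ≡ (S ^ f w) w → ¬ Redirected (mirror R) w
    w-not-S eq (pn-w , _) with pb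
    ... | inj₁ ((fw≡1 , single) , _) = P-moves w
            (subst (λ k → (P ^ k) w ≡ w) fw≡1 (proj₁ (single _) pn-w))
    ... | inj₂ (_ , _ , _ , far) = far (f w ∸ 1)
            (≤-reflexive (ℕ.m+[n∸m]≡n pos-w)) (Ball⇒Reach R {v = w} (dominates-Px pos-w eq))

    by-cases : Hit R x
    by-cases with InH? adj? f x w
    ... | yes hw = hit-by w≢v hw w-not-S
    ... | no ¬hw with any? (λ z → InH? adj? f x z ×-dec ¬? (z ≟ v))
    -- With `x` at its `S` end, `z` would dominate `P x`, which is private to `w`; but `w` does not
    -- dominate `x`.
    ... | yes (z , hz , z≢v) = hit-by z≢v hz λ eq _ → ¬hw (subst (InH G f x)
            (proj₂ Px-private z (Ball⇒InH R (proj₁ hz)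
              (Ball-mono {v = z} (ℕ.m∸n≤m (f z) 1) (dominates-Px (proj₁ hz) eq)))) hz)
    ... | no none = contradiction
            (Ball⇒InH R pos (f v , ≤-refl , inj₂ refl) ,
             λ z hz → decidable-stable (z ≟ v) λ z≢v → none (z , hz , z≢v)) ¬pn

  hit : ∀ R x → Hit R x
  hit R x with any? (InH? adj? f x)
  ... | no none = undominated-hit R λ v h → none (v , h)
  ... | yes (v , h) with dominated-hit R h
  ... | inj₁ hit                = hit
  ... | inj₂ (inj₁ (refl , red)) = redirected-hit R (proj₁ h) red
  ... | inj₂ (inj₂ (refl , red)) = Hit-mirror R (redirected-hit (mirror R) (proj₁ h) red)

  maximalIrredundant⇒ceil/3≤cost : Rotation G → ceil/3 (n G) ≤ cost G f
  maximalIrredundant⇒ceil/3≤cost R = covering⇒ceil/3≤cost {G} f (λ v → slots v (f v)) (λ v → short v (f v)) λ x →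
      let v , pos , h = hit R x in v , ∈-slots v (f v) pos h
    where
    slots : V G → ℕ → List (V G)
    slots v zero    = []
    -- Strength `suc k` gets `2 + (1 + (k + k))` entries; the ends are listed apart because either
    -- may be redirected.
    slots v (suc k) = endpoint R v ∷ endpoint (mirror R) v ∷ ballList R k v

    short : ∀ v k → length (slots v k) ≤ 3 * k
    short v zero    = z≤n
    short v (suc k) = begin
      2 + length (ballList R k v) ≡⟨ cong (2 +_) (length-ballList R k v) ⟩
      3 + (k + k)                 ≤⟨ ℕ.m≤n+m _ k ⟩
      k + (3 + (k + k))           ≡⟨ solve 1 (λ k → k :+ (con 3 :+ (k :+ k)) := con 3 :* (con 1 :+ k)) refl k ⟩
      3 * suc k                   ∎
      where
      open ℕ.≤-Reasoning
      open +-*-Solver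

    ∈-slots : ∀ v k {x} → 0 < k →
      (Rotation.Ball R (k ∸ 1) v x ⊎ EndSlot R v x ⊎ EndSlot (mirror R) v x) → x ∈ slots v k
    ∈-slots v (suc k) _ (inj₁ b)        = there (there (∈-ballList R k b))
    ∈-slots v (suc k) _ (inj₂ (inj₁ e)) = here (EndSlot⇒≡endpoint R {v} e)
    ∈-slots v (suc k) _ (inj₂ (inj₂ e)) = there (here (EndSlot⇒≡endpoint (mirror R) {v} e))

-- The cycle as a graph with a rotation

-- One orientation of `CycleAdj`. As a relation that is functional and injective, it yields both
-- inverse laws at once.
Next : ∀ {m} → Fin m → Fin m → Set
Next {m} i j = toℕ j ≡ suc (toℕ i) ⊎ (suc (toℕ i) ≡ m × toℕ j ≡ 0)

module _ {m : ℕ} where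

  Next-functional : ∀ {i j k : Fin m} → Next i j → Next i k → j ≡ k
  Next-functional (inj₁ p) (inj₁ q) = toℕ-injective (trans p (sym q))
  Next-functional {j = j} (inj₁ p) (inj₂ (q , _)) = contradiction (trans p q) (ℕ.<⇒≢ (toℕ<n j))
  Next-functional {k = k} (inj₂ (p , _)) (inj₁ q) = contradiction (trans q p) (ℕ.<⇒≢ (toℕ<n k))
  Next-functional (inj₂ (_ , p)) (inj₂ (_ , q)) = toℕ-injective (trans p (sym q))

  Next-injective : ∀ {i j k : Fin m} → Next i k → Next j k → i ≡ j
  Next-injective (inj₁ p) (inj₁ q) = toℕ-injective (ℕ.suc-injective (trans (sym p) q))
  Next-injective (inj₁ p) (inj₂ (_ , q)) = contradiction (trans (sym q) p) λ ()
  Next-injective (inj₂ (_ , p)) (inj₁ q) = contradiction (trans (sym p) q) λ ()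
  Next-injective (inj₂ (p , _)) (inj₂ (q , _)) = toℕ-injective (ℕ.suc-injective (trans p (sym q)))

  Next⇒Adj : ∀ {i j : Fin m} → Next i j → CycleAdj m i j
  Next⇒Adj (inj₁ p) = inj₁ p
  Next⇒Adj (inj₂ p) = inj₂ (inj₂ (inj₁ p))

  Prev⇒Adj : ∀ {i j : Fin m} → Next j i → CycleAdj m i j
  Prev⇒Adj (inj₁ p) = inj₂ (inj₁ p)
  Prev⇒Adj (inj₂ p) = inj₂ (inj₂ (inj₂ p))

  Adj⇒Next⊎Prev : ∀ {i j : Fin m} → CycleAdj m i j → Next i j ⊎ Next j i
  Adj⇒Next⊎Prev (inj₁ p)               = inj₁ (inj₁ p)
  Adj⇒Next⊎Prev (inj₂ (inj₁ p))        = inj₂ (inj₁ p)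
  Adj⇒Next⊎Prev (inj₂ (inj₂ (inj₁ p))) = inj₁ (inj₂ p)
  Adj⇒Next⊎Prev (inj₂ (inj₂ (inj₂ p))) = inj₂ (inj₂ p)

  cycleAdj? : DecidableAdj (Cycle m)
  cycleAdj? i j = toℕ j ℕ.≟ suc (toℕ i) ⊎-dec toℕ i ℕ.≟ suc (toℕ j)
    ⊎-dec (suc (toℕ i) ℕ.≟ m ×-dec toℕ j ℕ.≟ 0)
    ⊎-dec (suc (toℕ j) ℕ.≟ m ×-dec toℕ i ℕ.≟ 0)

next : ∀ {m} (i : Fin m) → ∃ (Next i)
next {suc m} i with m ℕ.≟ toℕ i
... | yes m≡i = zero , inj₂ (cong suc (sym m≡i) , refl)
... | no m≢i  = suc (lower₁ i m≢i) , inj₁ (cong suc (toℕ-lower₁ i m≢i))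

prev : ∀ {m} (i : Fin m) → ∃ λ j → Next j i
prev {suc m} zero    = fromℕ m , inj₂ (cong suc (toℕ-fromℕ m) , refl)
prev {suc m} (suc i) = inject₁ i , inj₁ (cong suc (sym (toℕ-inject₁ i)))

cycleRotation : ∀ {m} → 2 ≤ m → Rotation (Cycle m)
cycleRotation 2≤m = record
  { S       = proj₁ ∘ next
  ; P       = proj₁ ∘ prev
  ; S∘P     = λ x → Next-functional (proj₂ (next _)) (proj₂ (prev x))
  ; P∘S     = λ x → Next-injective (proj₂ (prev _)) (proj₂ (next x))
  ; adj-S   = λ x → Next⇒Adj (proj₂ (next x))
  ; adj-P   = λ x → Prev⇒Adj (proj₂ (prev x))
  ; adj-inv = λ {x} a → [ (λ p → inj₁ (Next-functional p (proj₂ (next x))))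
                        , (λ p → inj₂ (Next-injective p (proj₂ (prev x)))) ]′ (Adj⇒Next⊎Prev a)
  ; P-moves = λ x eq → irreflexive (subst (λ y → Next y x) eq (proj₂ (prev x)))
  }
  where
  irreflexive : ∀ {i} → ¬ Next i i
  irreflexive (inj₁ p) = ℕ.1+n≢n (sym p)
  -- A wrap-around from `i` to itself means `i` is 0 and `m` is 1.
  irreflexive (inj₂ (p , q)) = ℕ.<⇒≢ 2≤m (trans (cong suc (sym q)) p)

-- The broadcast on the multiples of 3

multipleOf3 : ℕ → ℕ
multipleOf3 0                   = 1
multipleOf3 1                   = 0
multipleOf3 2                   = 0
multipleOf3 (suc (suc (suc k))) = multipleOf3 k

multipleOf3≤1 : ∀ k → multipleOf3 k ≤ 1
multipleOf3≤1 0                   = ≤-refl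
multipleOf3≤1 1                   = z≤n
multipleOf3≤1 2                   = z≤n
multipleOf3≤1 (suc (suc (suc k))) = multipleOf3≤1 k

multipleOf3-suc : ∀ k → 0 < multipleOf3 k → ¬ 0 < multipleOf3 (suc k)
multipleOf3-suc 0                   _ ()
multipleOf3-suc (suc (suc (suc k))) p q = multipleOf3-suc k p q

multipleOf3-2+ : ∀ k → 0 < multipleOf3 k → ¬ 0 < multipleOf3 (2 + k)
multipleOf3-2+ 0                   _ ()
multipleOf3-2+ (suc (suc (suc k))) p q = multipleOf3-2+ k p q

multipleOf3-near : ∀ k → 0 < multipleOf3 k ⊎ (∃ λ j → k ≡ suc j × 0 < multipleOf3 j) ⊎ 0 < multipleOf3 (suc k)
multipleOf3-near 0 = inj₁ ≤-refl
multipleOf3-near 1 = inj₂ (inj₁ (0 , refl , ≤-refl))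
multipleOf3-near 2 = inj₂ (inj₂ ≤-refl)
multipleOf3-near (suc (suc (suc k))) with multipleOf3-near k
... | inj₁ p                     = inj₁ p
... | inj₂ (inj₁ (j , refl , p)) = inj₂ (inj₁ (3 + j , refl , p))
... | inj₂ (inj₂ p)              = inj₂ (inj₂ p)

sum-multipleOf3 : ∀ m → sum (tabulate {n = m} (multipleOf3 ∘ toℕ)) ≡ ceil/3 m
sum-multipleOf3 0                   = refl
sum-multipleOf3 1                   = refl
sum-multipleOf3 2                   = refl
sum-multipleOf3 (suc (suc (suc m))) = trans (cong suc (sum-multipleOf3 m))
  -- Each block of three vertices contributes 1, matching `(3 + m + 2) / 3 = 1 + (m + 2) / 3`.
  (sym (m/n≡1+[m∸n]/n {3 + m + 2} {3} (s≤s (s≤s (s≤s z≤n)))))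

module _ {m : ℕ} (3≤m : 3 ≤ m) where

  private
    G : Graph
    G = Cycle m

    R : Rotation G
    R = cycleRotation (≤-trans (ℕ.n≤1+n 2) 3≤m)

  every3rd : V G → ℕ
  every3rd = multipleOf3 ∘ toℕ

  cost-every3rd : cost G every3rd ≡ ceil/3 m
  cost-every3rd = trans (cong sum (map-tabulate {n = m} (λ i → i) every3rd)) (sum-multipleOf3 m)

  private
    ≡1 : ∀ {v} → 0 < every3rd v → every3rd v ≡ 1
    ≡1 {v} pos = ℕ.≤-antisym (multipleOf3≤1 (toℕ v)) pos

    InH-adj : ∀ {u v} → 0 < every3rd v → CycleAdj m u v → InH G every3rd u v
    InH-adj pos a = pos , Reach-mono pos (step a here)

    InH-inv : ∀ {u w} → InH G every3rd u w → u ≡ w ⊎ CycleAdj m u w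
    InH-inv {u} {w} (pos , r) with Reach-mono (multipleOf3≤1 (toℕ w)) r
    ... | here        = inj₁ refl
    ... | step a here = inj₂ a

  every3rd-broadcast : IsBroadcast G every3rd
  every3rd-broadcast v = Rotation.S R v , λ j j< r →
    Rotation.S-moves R v (sym (Reach-zero (Reach-mono (s≤s⁻¹ (≤-trans j< (multipleOf3≤1 (toℕ v)))) r)))

  every3rd-dominating : IsDominating G every3rd
  every3rd-dominating = every3rd-broadcast , dom
    where
    dom : ∀ u → ∃ (InH G every3rd u)
    dom u with multipleOf3-near (toℕ u)
    ... | inj₁ p = u , p , here
    ... | inj₂ (inj₁ (j , u≡ , p)) = fromℕ< j<m , InH-adj (subst (λ k → 0 < multipleOf3 k) (sym (toℕ-fromℕ< j<m)) p)
            (inj₂ (inj₁ (trans u≡ (cong suc (sym (toℕ-fromℕ< j<m))))))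
      where
      j<m : j < m
      j<m = ≤-trans (≤-reflexive (sym u≡)) (ℕ.<⇒≤ (toℕ<n u))
    ... | inj₂ (inj₂ p) with next u
    ...   | v , nx@(inj₁ v≡)      = v , InH-adj (subst (λ k → 0 < multipleOf3 k) (sym v≡) p) (Next⇒Adj nx)
    -- The last vertex wraps around to 0, which has strength 1 whatever the residue of `m`.
    ...   | v , nx@(inj₂ (_ , v≡0)) = v , InH-adj (subst (λ k → 0 < multipleOf3 k) (sym v≡0) ≤-refl) (Next⇒Adj nx)

  private
    boundary-neighbour : ∀ {u v} → 0 < every3rd v → CycleAdj m u v → ¬ 0 < every3rd u →
      (∀ w → 0 < every3rd w → CycleAdj m u w → w ≡ v) → InPB G every3rd v u
    boundary-neighbour {u} {v} pos a u∉ only =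
      inj₂ ((λ (_ , single) → u≢v (proj₁ (single u) pn)) , pn , proj₂ (proj₁ pn) ,
            λ j j< r → u≢v (Reach-zero (Reach-mono (s≤s⁻¹ (subst (j <_) (≡1 {v} pos) j<)) r)))
      where
      u≢v : u ≢ v
      u≢v refl = u∉ pos

      pn : InPN G every3rd v u
      pn = InH-adj pos a , λ w h → [ (λ { refl → contradiction (proj₁ h) u∉ }) , only w (proj₁ h) ]′ (InH-inv h)

  -- The private neighbour of v is v − 1, except that 0 uses 1: the vertex
  -- m − 1 preceding 0 may be dominated by the last multiple of 3 as well.
  every3rd-irredundant : IsIrredundant G every3rd
  every3rd-irredundant = every3rd-broadcast , λ v pos → private-boundary v (toℕ v) refl pos
    where
    private-boundary : ∀ v k → toℕ v ≡ k → 0 < every3rd v → ∃ (InPB G every3rd v)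
    private-boundary v zero v≡0 pos = u , boundary-neighbour pos (inj₂ (inj₁ (trans u≡1 (cong suc (sym v≡0)))))
        (λ p → multipleOf3-suc 0 ≤-refl (subst (λ k → 0 < multipleOf3 k) u≡1 p)) only
      where
      1<m : 1 < m
      1<m = ≤-trans (ℕ.n≤1+n 2) 3≤m

      u : V G
      u = fromℕ< 1<m

      u≡1 : toℕ u ≡ 1
      u≡1 = toℕ-fromℕ< 1<m

      only : ∀ w → 0 < every3rd w → CycleAdj m u w → w ≡ v
      only w p a with Adj⇒Next⊎Prev a
      ... | inj₁ (inj₁ w≡) = contradiction (subst (λ k → 0 < multipleOf3 k) (trans w≡ (cong suc u≡1)) p) λ ()
      -- The vertex 1 would be the last one only for `m = 2`.
      ... | inj₁ (inj₂ (u+1≡m , _)) = contradiction (trans (cong suc (sym u≡1)) u+1≡m) (ℕ.<⇒≢ 3≤m)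
      ... | inj₂ (inj₁ u≡) = toℕ-injective (trans (ℕ.suc-injective (trans (sym u≡) u≡1)) (sym v≡0))
      ... | inj₂ (inj₂ (_ , u≡0)) = contradiction (trans (sym u≡1) u≡0) λ ()
    private-boundary v (suc k) v≡ pos with prev v
    ... | u , inj₂ (_ , v≡0) = contradiction (trans (sym v≡) v≡0) λ ()
    ... | u , nx@(inj₁ v≡1+u) = u , boundary-neighbour pos (Next⇒Adj nx)
        (λ p → multipleOf3-suc (toℕ u) p pos′) only
      where
      pos′ : 0 < multipleOf3 (suc (toℕ u))
      pos′ = subst (λ k → 0 < multipleOf3 k) v≡1+u pos

      only : ∀ w → 0 < every3rd w → CycleAdj m u w → w ≡ v
      only w p a with Adj⇒Next⊎Prev a
      ... | inj₁ u→w = Next-functional u→w nx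
      ... | inj₂ (inj₁ u≡) = contradiction (subst (λ k → 0 < multipleOf3 (suc k)) u≡ pos′) (multipleOf3-2+ (toℕ w) p)
      ... | inj₂ (inj₂ (_ , u≡0)) = contradiction (subst (λ k → 0 < multipleOf3 (suc k)) u≡0 pos′) λ ()

theorem3p13 : (n : ℕ) → 3 ≤ n → IrB≡ (Cycle n) (ceil/3 n) × γB≡ (Cycle n) (ceil/3 n)
theorem3p13 n 3≤n =
  ( (every3rd 3≤n
      , dominating∧irredundant⇒maximal (every3rd-dominating 3≤n) (every3rd-irredundant 3≤n)
      , cost-every3rd 3≤n)
  , λ f max → maximalIrredundant⇒ceil/3≤cost cycleAdj? max R)
  , (every3rd 3≤n , every3rd-dominating 3≤n , cost-every3rd 3≤n)
  , dominating⇒ceil/3≤cost R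
  where
  R : Rotation (Cycle n)
  R = cycleRotation (≤-trans (ℕ.n≤1+n 2) 3≤n)
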